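{- If $R$ is a symmetric binary relation on a set $A$, $R$ contains an odd cycle, and $R$ is compatible with a near unanimity operation on $A$, then $R$ contains a loop, i.e., a pair $(a,a)\in R$.
   Context: The set $A$ may be infinite. An $n$-ary operation $f$ on $A$ with $n>2$ is a near unanimity operation if $f(x,\dots,x,y,x,\dots,x)=x$ for any $x,y\in A$ and any position of $y$ in the $n$-tuple of arguments. $R\subseteq A^2$ is compatible with $f$ if applying $f$ coordinate-wise to any $n$ pairs in $R$ gives a pair in $R$. A cycle of length $k$ in $R$ is a tuple $(a_1,\dots,a_{k+1})$ of elements of $A$ with $(a_i,a_{i+1})\in R$ for $i=1,\dots,k$ and $a_1=a_{k+1}$ (vertices may repeat); it is odd if $k$ is odd. -}

module Defs where

open import Data.Fin.Base using (Fin; suc; inject₁)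
open import Data.Nat.Base using (ℕ; suc; parity; _<_)
open import Data.Parity.Base using (1ℙ)
open import Data.Product.Base using (_×_; ∃-syntax)
open import Data.Vec.Base using (Vec; head; last; lookup; replicate; _[_]≔_)
open import Data.Vec.Relation.Binary.Pointwise.Inductive using (Pointwise)
open import Level using (Level; _⊔_)
open import Relation.Binary.Core using (Rel)
open import Relation.Binary.PropositionalEquality.Core using (_≡_)

private
  variable
    a ℓ : Level

-- Arguments are passed as an inductive vector rather than a function Fin n → A,
-- so that an operation depends only on its entries without assuming function
-- extensionality.
Operation : ℕ → Set a → Set a
Operation n A = Vec A n → A

IsNearUnanimity : ∀ {A : Set a} {n} → Operation n A → Set a
IsNearUnanimity {A = A} {n = n} f =
  2 < n × (∀ (x y : A) (i : Fin n) → f (replicate n x [ i ]≔ y) ≡ x)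

-- The n pairs in R are given by the vectors of their first and of their second
-- coordinates.
Compatible : ∀ {A : Set a} {n} → Rel A ℓ → Operation n A → Set (a ⊔ ℓ)
Compatible {A = A} {n = n} R f =
  ∀ (xs ys : Vec A n) → Pointwise R xs ys → R (f xs) (f ys)

IsCycle : {A : Set a} → Rel A ℓ → (k : ℕ) → Vec A (suc k) → Set (a ⊔ ℓ)
IsCycle R k v =
  (∀ (i : Fin k) → R (lookup v (inject₁ i)) (lookup v (suc i))) × head v ≡ last v

HasOddCycle : {A : Set a} → Rel A ℓ → Set (a ⊔ ℓ)
HasOddCycle {A = A} R =
  ∃[ k ] parity k ≡ 1ℙ × (∃[ v ] IsCycle R k v)

HasLoop : {A : Set a} → Rel A ℓ → Set (a ⊔ ℓ)
HasLoop R = ∃[ x ] R x x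

{-# OPTIONS --safe #-}

-- Call c a centre of coordinate j if f sends related tuples to related elements
-- even when, in coordinate j, the edges between c and all non-isolated vertices
-- are added to R.  If every coordinate j has a centre c j, then x = f(c) is a
-- loop: x is not isolated, so c and (x,…,x) are related in the extended sense,
-- hence f(c) = x is related to f(x,…,x) = x.
--
-- Centres survive replacing R by an odd power of R, and restricting R to the
-- neighbourhood of a vertex a; by near unanimity, the latter also makes a a
-- centre of any one chosen coordinate.  If R has an odd cycle of length k + 2,
-- then R^k has a triangle a, b, c, and a loop in R^k is a shorter odd cycle in R.
-- The neighbourhood of a contains an odd cycle again: from (b,…,b), move the
-- coordinates one at a time to c along b, a, c while the others bounce along
-- b, c, b or c, b, c; under f this is a walk of even length from b to c among
-- neighbours of a.  Induct on the number of coordinates without a centre and,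
-- inside that, on the length of the odd cycle.
module Submission where

open import Defs
open import Data.Empty.Polymorphic using (⊥)
open import Data.Fin.Base using (Fin; zero; suc; toℕ; fromℕ<; inject₁)
open import Data.Fin.Properties using (toℕ-injective; toℕ-fromℕ<; toℕ<n; _≟_)
open import Data.Nat.Base using (ℕ; zero; suc; _≤_; _<_; z≤n; s≤s; s≤s⁻¹; parity)
open import Data.Nat.Properties
  using (<-cmp; ≤-refl; ≤-trans; <⇒≤; ≤⇒≯; m<n⇒m<1+n; n<1+n; m≤n⇒m<n∨m≡n; <⇒≱)
open import Data.Parity.Base using (1ℙ)
open import Data.Product.Base using (_×_; _,_; proj₁; proj₂; ∃; ∃-syntax; map₂)
open import Data.Sum.Base using (_⊎_; inj₁; inj₂)
open import Data.Vec.Base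
  using (Vec; []; _∷_; head; last; lookup; replicate; tabulate; _[_]≔_)
open import Data.Vec.Properties
  using (tabulate-cong; tabulate∘lookup; lookup∘update; lookup∘update′; lookup-replicate)
open import Data.Vec.Relation.Binary.Pointwise.Inductive using (tabulate⁺)
open import Function.Base using (_∘_; const)
open import Level using (Level; _⊔_; Lift; lift; lower)
open import Relation.Binary.Core using (Rel; _⇒_)
open import Relation.Binary.Definitions using (Symmetric; tri<; tri≈; tri>)
open import Relation.Binary.PropositionalEquality
  using (_≡_; _≢_; _≗_; refl; sym; trans; cong; subst)
open import Relation.Nullary using (yes; no; contradiction)
open import Relation.Unary using (Pred)

private
  variable
    a ℓ : Level
    A : Set a

-- Odd powers of a relation, as walks.

-- The walks of length 2k + 1.
data OddWalk {A : Set a} (R : Rel A ℓ) : ℕ → Rel A (a ⊔ ℓ) where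
  edge : ∀ {x y} → R x y → OddWalk R 0 x y
  step : ∀ {k x y z w} → R x y → R y z → OddWalk R k z w → OddWalk R (suc k) x w

module _ {R : Rel A ℓ} where

  edge⁻ : ∀ {x y} → OddWalk R 0 x y → R x y
  edge⁻ (edge p) = p

  step⁻ : ∀ {k x w} → OddWalk R (suc k) x w →
    ∃[ y ] ∃[ z ] R x y × R y z × OddWalk R k z w
  step⁻ (step p q w) = _ , _ , p , q , w

  snoc : ∀ {k x y z w} → OddWalk R k x y → R y z → R z w → OddWalk R (suc k) x w
  snoc (edge p)     r s = step p r (edge s)
  snoc (step p q w) r s = step p q (snoc w r s)

  OddWalk-sym : Symmetric R → ∀ {k} → Symmetric (OddWalk R k)
  OddWalk-sym R-sym (edge p)     = edge (R-sym p)
  OddWalk-sym R-sym (step p q w) = snoc (OddWalk-sym R-sym w) (R-sym q) (R-sym p)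

  bounce : ∀ k {x y} → R x y → R y x → OddWalk R k x y
  bounce zero    p q = edge p
  bounce (suc k) p q = step p q (bounce k p q)

OddWalk-map : ∀ {ℓ′} {R : Rel A ℓ} {S : Rel A ℓ′} → R ⇒ S →
  ∀ {k} → OddWalk R k ⇒ OddWalk S k
OddWalk-map f (edge p)     = edge (f p)
OddWalk-map f (step p q w) = step (f p) (f q) (OddWalk-map f w)

cycle⇒OddWalk : ∀ {R : Rel A ℓ} k (v : Vec A (suc k)) → parity k ≡ 1ℙ →
  (∀ (i : Fin k) → R (lookup v (inject₁ i)) (lookup v (suc i))) →
  ∃[ l ] OddWalk R l (head v) (last v)
cycle⇒OddWalk 0 v () edges
cycle⇒OddWalk 1 (x ∷ y ∷ []) odd edges = 0 , edge (edges zero)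
cycle⇒OddWalk (suc (suc k)) (x ∷ y ∷ z ∷ v) odd edges
  -- `parity` recurses in steps of two, so `odd` serves the shorter walk unchanged.
  with l , w ← cycle⇒OddWalk k (z ∷ v) odd (λ i → edges (suc (suc i)))
  = suc l , step (edges zero) (edges (suc zero)) w

-- Centres and neighbourhoods.

NonIsolated : {A : Set a} → Rel A ℓ → Pred A (a ⊔ ℓ)
NonIsolated R x = ∃[ y ] R x y

OddWalk-NonIsolated : ∀ {R : Rel A ℓ} {k x} → NonIsolated (OddWalk R k) x → NonIsolated R x
OddWalk-NonIsolated (_ , edge p)     = _ , p
OddWalk-NonIsolated (_ , step p _ _) = _ , p

-- A centre is joined to non-isolated vertices only: in the restriction to the neighbourhood of `a`
-- these are neighbours of `a`, so edges added at `a` already lie in the original relation.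
data Extended {A : Set a} (C : Pred A ℓ) (R : Rel A ℓ) : Rel A (a ⊔ ℓ) where
  old     : ∀ {x y} → R x y → Extended C R x y
  centreˡ : ∀ {x y} → C x → NonIsolated R y → Extended C R x y
  centreʳ : ∀ {x y} → NonIsolated R x → C y → Extended C R x y

-- An end that is non-isolated in the power is non-isolated in `R`, so the added edge exists over
-- `R` too; going back and forth along it gives the odd length.
Extended-OddWalk : ∀ {A : Set a} {C : Pred A (a ⊔ ℓ)} {R : Rel A (a ⊔ ℓ)} {k} →
  Extended C (OddWalk R k) ⇒ OddWalk (Extended C R) k
Extended-OddWalk (old w)       = OddWalk-map old w
Extended-OddWalk (centreˡ c d) =
  let d′ = OddWalk-NonIsolated d in bounce _ (centreˡ c d′) (centreʳ d′ c)
Extended-OddWalk (centreʳ d c) =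
  let d′ = OddWalk-NonIsolated d in bounce _ (centreʳ d′ c) (centreˡ c d′)

Extended-sym : ∀ {C : Pred A ℓ} {R : Rel A ℓ} → Symmetric R → Symmetric (Extended C R)
Extended-sym R-sym (old p)       = old (R-sym p)
Extended-sym R-sym (centreˡ c d) = centreʳ d c
Extended-sym R-sym (centreʳ d c) = centreˡ c d

restrict : Rel A ℓ → A → Rel A ℓ
restrict R a x y = R x y × R a x × R a y

restrict-sym : ∀ {R : Rel A ℓ} {a} → Symmetric R → Symmetric (restrict R a)
restrict-sym R-sym (p , ax , ay) = R-sym p , ay , ax

addCentre : ∀ {A : Set a} {n} → (Fin n → Pred A (a ⊔ ℓ)) → Fin n → A → Fin n → Pred A (a ⊔ ℓ)
addCentre {ℓ = ℓ} C i a j x = C j x ⊎ Lift ℓ (j ≡ i × x ≡ a)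

-- Tuples constant off one coordinate, or split at one.

tabulate-update : ∀ {n} (i : Fin n) (u : Fin n → A) {x} →
  (∀ j → j ≢ i → u j ≡ x) → replicate n x [ i ]≔ u i ≡ tabulate u
tabulate-update {n = n} i u {x} others =
  trans (sym (tabulate∘lookup (replicate n x [ i ]≔ u i))) (tabulate-cong entry)
  where
  entry : lookup (replicate n x [ i ]≔ u i) ≗ u
  entry j with j ≟ i
  ... | yes refl = lookup∘update i (replicate n x) (u i)
  ... | no j≢i   = trans (lookup∘update′ j≢i (replicate n x) (u i))
                         (trans (lookup-replicate j x) (sym (others j j≢i)))

-- In the closed walk built below, coordinates before `m` have been moved, coordinate `m` is being
-- moved, and later ones wait.
splitAt : ∀ {n} → A → A → A → ℕ → Fin n → A
splitAt x y z m j with <-cmp (toℕ j) m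
... | tri< _ _ _ = x
... | tri≈ _ _ _ = y
... | tri> _ _ _ = z

splitAt-zero : ∀ {n} (x y : A) (j : Fin n) → splitAt x y y 0 j ≡ y
splitAt-zero x y j with <-cmp (toℕ j) 0
... | tri< () _ _
... | tri≈ _ _ _ = refl
... | tri> _ _ _ = refl

splitAt-full : ∀ {n} (x y : A) (j : Fin n) → splitAt x y y n j ≡ x
splitAt-full {n = n} x y j with <-cmp (toℕ j) n
... | tri< _ _ _   = refl
... | tri≈ j≮n _ _ = contradiction (toℕ<n j) j≮n
... | tri> j≮n _ _ = contradiction (toℕ<n j) j≮n

splitAt-suc : ∀ {n} (x y : A) m (j : Fin n) → splitAt x x y m j ≡ splitAt x y y (suc m) j
splitAt-suc x y m j with <-cmp (toℕ j) m | <-cmp (toℕ j) (suc m)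
... | tri< _ _ _   | tri< _ _ _    = refl
... | tri< j<m _ _ | tri≈ j≮1+m _ _ = contradiction (m<n⇒m<1+n j<m) j≮1+m
... | tri< j<m _ _ | tri> j≮1+m _ _ = contradiction (m<n⇒m<1+n j<m) j≮1+m
... | tri≈ _ _ _   | tri< _ _ _    = refl
... | tri≈ _ refl _ | tri≈ j≮1+m _ _ = contradiction (n<1+n _) j≮1+m
... | tri≈ _ refl _ | tri> j≮1+m _ _ = contradiction (n<1+n _) j≮1+m
... | tri> _ _ m<j | tri< j<1+m _ _ = contradiction (s≤s⁻¹ j<1+m) (<⇒≱ m<j)
... | tri> _ _ _   | tri≈ _ _ _    = refl
... | tri> _ _ _   | tri> _ _ _    = refl

-- Centres under a near unanimity operation.

module _ {a ℓ : Level} {A : Set a} {n} (f : Operation n A) (nu : IsNearUnanimity f) where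

  private
    L : Level
    L = a ⊔ ℓ

  f̂ : (Fin n → A) → A
  f̂ u = f (tabulate u)

  f̂-cong : ∀ {u v} → u ≗ v → f̂ u ≡ f̂ v
  f̂-cong eq = cong f (tabulate-cong eq)

  f̂-nu : ∀ i u {x} → (∀ j → j ≢ i → u j ≡ x) → f̂ u ≡ x
  f̂-nu i u {x} others =
    trans (cong f (sym (tabulate-update i u others))) (proj₂ nu x (u i) i)

  f̂-idem : ∀ x → f̂ (const x) ≡ x
  f̂-idem x = f̂-nu (fromℕ< (≤-trans (s≤s z≤n) (proj₁ nu))) (const x) (λ _ _ → refl)

  -- All coordinates may use their added edges at the same time.
  Centred : (Fin n → Pred A L) → Rel A L → Set L
  Centred C R = ∀ {u v} → (∀ j → Extended (C j) R (u j) (v j)) → R (f̂ u) (f̂ v)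

  Centred-OddWalk : ∀ {C R} → Centred C R → ∀ k → Centred C (OddWalk R k)
  Centred-OddWalk {C} {R} centred k ws = walks k (λ j → Extended-OddWalk {ℓ = ℓ} (ws j))
    where
    walks : ∀ k {u v} → (∀ j → OddWalk (Extended (C j) R) k (u j) (v j)) →
      OddWalk R k (f̂ u) (f̂ v)
    walks zero    ws = edge (centred (edge⁻ ∘ ws))
    walks (suc k) ws = step (centred (proj₁ ∘ proj₂ ∘ proj₂ ∘ step⁻ ∘ ws))
                            (centred (proj₁ ∘ proj₂ ∘ proj₂ ∘ proj₂ ∘ step⁻ ∘ ws))
                            (walks k (proj₂ ∘ proj₂ ∘ proj₂ ∘ proj₂ ∘ step⁻ ∘ ws))

  -- Edges added at `a` lie in `R`, so the hypothesis on `R` applies; it applies again to make both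
  -- values neighbours of `a`. The neighbour `p` keeps `a` non-isolated and is the partner of `a`
  -- itself.
  Centred-restrict : ∀ {C R p} → Symmetric R → Centred C R → ∀ i a → R a p →
    Centred (addCentre {ℓ = ℓ} C i a) (restrict R a)
  Centred-restrict {C} {R} {p} R-sym centred i a Rap {u} {v} ws =
    centred (λ j → weaken (ws j)) , neighbour {v = v} ws ,
    neighbour {v = u} (λ j → Extended-sym (restrict-sym {R = R} {a} R-sym) (ws j))
    where
    C′ : Fin n → Pred A L
    C′ = addCentre {ℓ = ℓ} C i a

    weaken : ∀ {j} → Extended (C′ j) (restrict R a) ⇒ Extended (C j) R
    weaken (old (q , _))                                       = old q
    weaken (centreˡ (inj₁ c) (_ , q , _))                      = centreˡ c (_ , q)
    weaken (centreˡ (inj₂ (lift (_ , refl))) (_ , _ , ax , _)) = old ax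
    weaken (centreʳ (_ , q , _) (inj₁ c))                      = centreʳ (_ , q) c
    weaken (centreʳ (_ , _ , ax , _) (inj₂ (lift (_ , refl)))) = old (R-sym ax)

    -- Only in coordinate i, where a itself may occur, can a fail to be a
    -- neighbour; near unanimity absorbs that coordinate.
    partner : ∀ {j x y} → Extended (C′ j) (restrict R a) x y →
      ∃[ z ] Extended (C j) R z x × (j ≢ i → z ≡ a)
    partner (old (_ , ax , _))                     = a , old ax , λ _ → refl
    partner (centreˡ (inj₁ c) _)                   = a , centreʳ (p , Rap) c , λ _ → refl
    partner (centreˡ (inj₂ (lift (j≡i , refl))) _) =
      p , old (R-sym Rap) , contradiction j≡i
    partner (centreʳ (_ , _ , ax , _) _)           = a , old ax , λ _ → refl

    neighbour : ∀ {u v} → (∀ j → Extended (C′ j) (restrict R a) (u j) (v j)) → R a (f̂ u)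
    neighbour {u} {v} ws = subst (λ x → R x (f̂ u))
      (f̂-nu i (proj₁ ∘ partner ∘ ws) (λ j → proj₂ (proj₂ (partner (ws j)))))
      (centred (λ j → proj₁ (proj₂ (partner (ws j)))))

  restrict-oddCycle : ∀ {C R x y z} → Symmetric R → Centred C R →
    R x y → R y z → R x z → OddWalk (restrict R x) n z z
  restrict-oddCycle {C} {R} {x} {y} {z} R-sym centred xy yz xz =
    subst (OddWalk (restrict R x) n z)
      (trans (f̂-cong (splitAt-full z y)) (f̂-idem z)) (walk n ≤-refl)
    where
    zy : restrict R x z y
    zy = R-sym yz , xz , xy

    yz′ : restrict R x y z
    yz′ = yz , xy , xz

    module _ {m} (m<n : m < n) where
      i : Fin n
      i = fromℕ< m<n

      j≡i : ∀ {j : Fin n} → toℕ j ≡ m → j ≡ i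
      j≡i eq = toℕ-injective (trans eq (sym (toℕ-fromℕ< m<n)))

      E : Fin n → Rel A L
      E j = Extended (addCentre {ℓ = ℓ} C i x j) (restrict R x)

      there : ∀ j → E j (splitAt z y y m j) (splitAt y x z m j)
      there j with <-cmp (toℕ j) m
      ... | tri< _ _ _  = old zy
      ... | tri≈ _ eq _ = centreʳ (z , yz′) (inj₂ (lift (j≡i eq , refl)))
      ... | tri> _ _ _  = old yz′

      back : ∀ j → E j (splitAt y x z m j) (splitAt z z y m j)
      back j with <-cmp (toℕ j) m
      ... | tri< _ _ _  = old yz′
      ... | tri≈ _ eq _ = centreˡ (inj₂ (lift (j≡i eq , refl))) (y , zy)
      ... | tri> _ _ _  = old zy

    walk : ∀ m → m ≤ n → OddWalk (restrict R x) m z (f̂ (splitAt z y y m))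
    -- This opening edge makes the total length `2n + 1`; each coordinate then costs two steps.
    walk zero    _   =
      edge (subst (restrict R x z) (sym (trans (f̂-cong (splitAt-zero z y)) (f̂-idem y))) zy)
    walk (suc m) m<n =
      subst (OddWalk (restrict R x) (suc m) z) (f̂-cong (splitAt-suc z y m))
        (snoc (walk m (<⇒≤ m<n)) (move (there m<n)) (move (back m<n)))
      where
      -- The centre `x` is added afresh in each round, only in the coordinate that passes through
      -- `x`.
      move : Centred (addCentre {ℓ = ℓ} C (fromℕ< m<n) x) (restrict R x)
      move = Centred-restrict R-sym centred (fromℕ< m<n) x xy

  centres⇒loop : ∀ {C R y} → Centred C R → (∀ j → ∃ (C j)) → NonIsolated R y → HasLoop R
  -- `Rx` on `y` shows that `x` is not isolated, and then applies to `x` itself.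
  centres⇒loop {C} {R} {y} centred cs d = x , Rx (_ , Rx d)
    where
    x : A
    x = f̂ (proj₁ ∘ cs)

    Rx : ∀ {z} → NonIsolated R z → R x z
    Rx {z} d = subst (R x) (f̂-idem z) (centred (λ j → centreˡ (proj₂ (cs j)) d))

  -- Lexicographic induction on `m` and `k`: passing to a neighbourhood lowers `m` and resets `k` to
  -- `n`; the loop found there lowers `k` at the same `m`.
  oddCycle⇒loop : ∀ m {C R} → Symmetric R → Centred C R → m ≤ n →
    (∀ j → m ≤ toℕ j → ∃ (C j)) → ∀ k {x} → OddWalk R k x x → HasLoop R
  oddCycle⇒loop m       R-sym centred m≤n cs zero    (edge p)     = _ , p
  oddCycle⇒loop zero    R-sym centred m≤n cs (suc k) (step p _ _) =
    centres⇒loop centred (λ j → cs j z≤n) (_ , p)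
  oddCycle⇒loop (suc m) {C} {R} R-sym centred m<n cs (suc k) {x} (step p q w) =
    oddCycle⇒loop (suc m) R-sym centred m<n cs k (proj₁ (proj₂ loop))
    where
    i : Fin n
    i = fromℕ< m<n

    Rᵏ-sym : Symmetric (OddWalk R k)
    Rᵏ-sym = OddWalk-sym R-sym

    Rᵏ-centred : Centred C (OddWalk R k)
    Rᵏ-centred = Centred-OddWalk centred k

    xy : OddWalk R k x _
    xy = bounce k p (R-sym p)

    cs′ : ∀ j → m ≤ toℕ j → ∃ (addCentre {ℓ = ℓ} C i x j)
    cs′ j m≤j with m≤n⇒m<n∨m≡n m≤j
    ... | inj₁ m<j = map₂ inj₁ (cs j m<j)
    ... | inj₂ m≡j =
      x , inj₂ (lift (toℕ-injective (trans (sym m≡j) (sym (toℕ-fromℕ< m<n))) , refl))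

    -- The first two edges of the cycle, bounced, and the rest of it form a triangle in the power.
    loop : HasLoop (restrict (OddWalk R k) x)
    loop = oddCycle⇒loop m (restrict-sym {R = OddWalk R k} Rᵏ-sym)
      (Centred-restrict Rᵏ-sym Rᵏ-centred i x xy) (<⇒≤ m<n) cs′ n
      (restrict-oddCycle Rᵏ-sym Rᵏ-centred xy (bounce k q (R-sym q)) (Rᵏ-sym w))

corollary4p6 : ∀ {a ℓ : Level} {A : Set a} (R : Rel A ℓ) →
    Symmetric R →
    HasOddCycle R →
    (n : ℕ) (f : Operation n A) → IsNearUnanimity f → Compatible R f →
    HasLoop R
corollary4p6 {a} {ℓ} {A} R R-sym (k , odd , v , edges , closed) n f nu compat
  with l , w ← cycle⇒OddWalk {R = R} k v odd edges =
  -- With no centres yet, `m` starts at `n`, where the condition on later coordinates is vacuous.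
  map₂ lower (oddCycle⇒loop {ℓ = ℓ} f nu n {C = λ _ _ → ⊥} {R = R↑}
    (λ (lift p) → lift (R-sym p)) centred ≤-refl
    (λ j n≤j → contradiction (toℕ<n j) (≤⇒≯ n≤j)) l
    (OddWalk-map lift (subst (OddWalk R l (head v)) (sym closed) w)))
  where
  -- Lifted to the level of walks, since the induction replaces the relation by its powers.
  R↑ : Rel A (a ⊔ ℓ)
  R↑ x y = Lift a (R x y)

  centred : Centred {ℓ = ℓ} f nu (λ _ _ → ⊥) R↑
  centred ws = lift (compat _ _ (tabulate⁺ λ j → original (ws j)))
    where
    original : ∀ {x y} → Extended (λ _ → ⊥) R↑ x y → R x y
    original (old (lift p)) = p
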